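{- Let $(\mathcal N,\mathcal O,\mathfrak l)$ be a plabic network with perfect orientation $\mathcal O$, positive edge weights $w_e$ and gauge ray direction $\mathfrak l$, and let $E_e$ be its edge vectors. Then the edge vectors satisfy the following linear equations at each internal vertex. (1) At each bivalent vertex with incoming edge $e$ and outgoing edge $f$: $$E_e=(-1)^{\mathrm{int}(e)+\mathrm{wind}(e,f)}\,w_e\,E_f .$$ (2) At each trivalent black vertex with incoming edges $e_2,e_3$ and outgoing edge $e_1$: $$E_{e_2}=(-1)^{\mathrm{int}(e_2)+\mathrm{wind}(e_2,e_1)}\,w_{e_2}E_{e_1},\qquad E_{e_3}=(-1)^{\mathrm{int}(e_3)+\mathrm{wind}(e_3,e_1)}\,w_{e_3}E_{e_1}.$$ (3) At each trivalent white vertex with incoming edge $e_3$ and outgoing edges $e_1,e_2$: $$E_{e_3}=(-1)^{\mathrm{int}(e_3)+\mathrm{wind}(e_3,e_1)}\,w_{e_3}E_{e_1}+(-1)^{\mathrm{int}(e_3)+\mathrm{wind}(e_3,e_2)}\,w_{e_3}E_{e_2}.$$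
   Context: **Plabic networks.** Let $D$ be a closed convex disk whose boundary contains a straight segment. A plabic graph $\mathcal G$ is a finite directed planar graph embedded in $D$ with straight edges. It has boundary vertices $b_1,\dots,b_n$ on the segment, labelled clockwise, each of degree 1 (a source if its edge is outgoing, a sink otherwise). The remaining (internal) vertices lie inside $D$ and have degree 2 or 3. No component is isolated from the boundary. The graph is perfect: each internal vertex has exactly one incoming edge (then it is white) or exactly one outgoing edge (then it is black); a bivalent vertex has one incoming and one outgoing edge and is given either color. The orientation $\mathcal O$ is called a perfect orientation. $I=\{i_1<\dots<i_k\}$ is the set of indices of the boundary sources and $\bar I=[n]\setminus I$. A network $\mathcal N$ is $\mathcal G$ with a positive weight $w_e$ on each edge. **Gauge rays.** A gauge ray direction $\mathfrak l$ is an oriented direction, not parallel to any edge, such that the rays with direction $\mathfrak l$ starting at boundary vertices point inside $D$ and contain no internal vertices. The gauge rays are the rays $\mathfrak l_{i_r}$ starting at the boundary sources $b_{i_r}$. $\mathrm{int}(e)$ is the number of intersections of the edge $e$ with the gauge rays (the base point of a ray is not counted). **Winding.** For nonzero planar vectors, $s(a,b)=+1,0,-1$ if the ordered pair $(a,b)$ is positively oriented, parallel, negatively oriented respectively. For consecutive directed edges $e,f$: $\mathrm{wind}(e,f)=1$ if $s(e,f)=s(e,\mathfrak l)=s(\mathfrak l,f)=1$; $\mathrm{wind}(e,f)=-1$ if $s(e,f)=s(e,\mathfrak l)=s(\mathfrak l,f)=-1$; otherwise $0$. **Edge vectors.** For a directed path $\mathcal P=(e_1,\dots,e_m)$ (edges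 may repeat) put $w(\mathcal P)=\prod_l w_{e_l}$, $\mathrm{wind}(\mathcal P)=\sum_{l=1}^{m-1}\mathrm{wind}(e_l,e_{l+1})$, $\mathrm{int}(\mathcal P)=\sum_l \mathrm{int}(e_l)$. The edge vector $E_e\in\mathbb R^n$ has components $$(E_e)_j=\sum_{\mathcal P:e\to b_j}(-1)^{\mathrm{wind}(\mathcal P)+\mathrm{int}(\mathcal P)}w(\mathcal P),$$ the sum being over all directed paths with first edge $e$ ending at $b_j$ (zero if there are none). If the sum is infinite it is understood as a formal power series in the weights (convergent for sufficiently small weights). At the edge $e$ ending at a boundary sink $b_j$, $(E_e)_l=(-1)^{\mathrm{int}(e)}w_e\delta_{jl}$. -}

module Defs where

open import Level using (0ℓ)
open import Algebra.Bundles using (CommutativeRing)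
import Algebra.Properties.Ring as RingProperties
open import Data.Empty using (⊥-elim)
open import Data.Fin as Fin using (Fin)
import Data.Fin.Properties as Fin
open import Data.Integer as ℤ using (ℤ; +_; +[1+_]; -[1+_]; 0ℤ; 1ℤ; -1ℤ)
open import Data.List
  using (List; []; _∷_; map; concatMap; filter; foldr; length; allFin; upTo)
open import Data.Nat as ℕ using (ℕ; zero; suc)
open import Data.Product using (∃; ∃-syntax; _×_; _,_; proj₁; proj₂)
open import Data.Sum using (_⊎_; inj₁; inj₂)
import Data.Sum.Properties as Sum
open import Data.Vec as Vec using (Vec)
import Data.Vec.Properties as Vec
open import Relation.Binary.Core using (Rel)
open import Relation.Binary.Definitions
  using (DecidableEquality; tri<; tri≈; tri>)
open import Relation.Binary.PropositionalEquality using (_≡_; _≢_)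
open import Relation.Binary.Structures using (IsStrictTotalOrder)
open import Relation.Binary.Construct.Closure.Equivalence using (EqClosure)
import Relation.Binary.Construct.StrictToNonStrict as NonStrict
import Relation.Binary.Reasoning.Setoid as SetoidReasoning
open import Relation.Nullary using (¬_; Dec; yes; no)
open import Relation.Nullary.Decidable using (_×-dec_; _⊎-dec_)
open import Relation.Unary using (Pred)

------------------------------------------------------------------------
-- The real numbers, axiomatised as a Dedekind-complete ordered field.
-- Trichotomy is part of the axioms: this is the classical real line,
-- unique up to isomorphism.

record Reals : Set₁ where
  field
    commutativeRing : CommutativeRing 0ℓ 0ℓ
  open CommutativeRing commutativeRing public
  infix 4 _<_
  field
    _<_                : Rel Carrier 0ℓ
    isStrictTotalOrder : IsStrictTotalOrder _≈_ _<_
    0≉1                : ¬ 0# ≈ 1#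
    +-monoˡ-<          : ∀ x {y z} → y < z → x + y < x + z
    *-pos              : ∀ {x y} → 0# < x → 0# < y → 0# < x * y
    inverse            : ∀ {x} → ¬ x ≈ 0# → ∃[ y ] x * y ≈ 1#
  open IsStrictTotalOrder isStrictTotalOrder public
    using (compare; _≟_; _<?_)
  open NonStrict _≈_ _<_ public using (_≤_)

  UpperBound : Pred Carrier 0ℓ → Carrier → Set
  UpperBound P u = ∀ {x} → P x → x ≤ u

  field
    supremum : (P : Pred Carrier 0ℓ) → ∃ P → ∃ (UpperBound P) →
               ∃[ s ] UpperBound P s × (∀ {u} → UpperBound P u → s ≤ u)

  open import Algebra.Properties.Semiring.Exp semiring public using (_^_)

  -- (-1)^z for an integer exponent, which depends only on the parity of z.
  -1^_ : ℤ → Carrier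
  -1^ z = (- 1#) ^ ℤ.∣ z ∣

  ∑ : {A : Set} → (A → Carrier) → List A → Carrier
  ∑ f xs = foldr _+_ 0# (map f xs)

  ∏ : {A : Set} → (A → Carrier) → List A → Carrier
  ∏ f xs = foldr _*_ 1# (map f xs)

  _⟶_ : (ℕ → Carrier) → Carrier → Set
  s ⟶ x = ∀ ε → 0# < ε → ∃[ N ] (∀ M → N ℕ.≤ M → (- ε < s M - x) × (s M - x < ε))

------------------------------------------------------------------------

module Plane (ℝ : Reals) where
  open Reals ℝ

  Point : Set
  Point = Carrier × Carrier

  infix  4 _≈ₚ_
  infixl 6 _⊕_ _⊖_
  infixl 7 _·_

  _≈ₚ_ : Rel Point 0ℓ
  (x , y) ≈ₚ (x′ , y′) = x ≈ x′ × y ≈ y′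

  _⊕_ _⊖_ : Point → Point → Point
  (x , y) ⊕ (x′ , y′) = x + x′ , y + y′
  (x , y) ⊖ (x′ , y′) = x - x′ , y - y′

  _·_ : Carrier → Point → Point
  c · (x , y) = c * x , c * y

  det : Point → Point → Carrier
  det (x , y) (x′ , y′) = x * y′ - y * x′

  -- s(a,b)
  orientation : Point → Point → ℤ
  orientation a b with compare 0# (det a b)
  ... | tri< _ _ _ = 1ℤ
  ... | tri≈ _ _ _ = 0ℤ
  ... | tri> _ _ _ = -1ℤ

  dist² : Point → Point → Carrier
  dist² (x , y) (x′ , y′) = (x - x′) * (x - x′) + (y - y′) * (y - y′)

  _∈[_,_] : Point → Point → Point → Set
  x ∈[ p , q ] = ∃[ u ] 0# ≤ u × u ≤ 1# × x ≈ₚ p ⊕ u · (q ⊖ p)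

  Interior : Pred Point 0ℓ → Pred Point 0ℓ
  Interior D x = ∃[ r ] 0# < r × (∀ y → dist² x y < r * r → D y)

  Closed : Pred Point 0ℓ → Set
  Closed D = ∀ x → (∀ r → 0# < r → ∃[ y ] D y × dist² x y < r * r) → D x

  Convex : Pred Point 0ℓ → Set
  Convex D = ∀ {p q x} → D p → D q → x ∈[ p , q ] → D x

  Bounded : Pred Point 0ℓ → Set
  Bounded D = ∃[ r ] (∀ {x y} → D x → D y → dist² x y ≤ r)

  -- A closed convex subset of the plane is a disk exactly when it is
  -- bounded and has interior points.
  record IsConvexDisk (D : Pred Point 0ℓ) : Set where
    field
      closed   : Closed D
      convex   : Convex D
      bounded  : Bounded D
      interior : ∃ (Interior D)

  -- The open ray from b in the direction l (base point excluded) meets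
  -- the closed segment from p to q.
  Meets : (l b p q : Point) → Set
  Meets l b p q =
    ∃[ t ] ∃[ u ] 0# < t × 0# ≤ u × u ≤ 1# × b ⊕ t · l ≈ₚ p ⊕ u · (q ⊖ p)

  private
    open RingProperties ring
    open SetoidReasoning setoid

    interchange : ∀ a b c d → (a + b) - (c + d) ≈ (a - c) + (b - d)
    interchange a b c d = begin
      (a + b) - (c + d)        ≈⟨ +-congˡ (-‿+-comm c d) ⟨
      (a + b) + (- c + - d)    ≈⟨ +-assoc a b _ ⟩
      a + (b + (- c + - d))    ≈⟨ +-congˡ (+-assoc b _ _) ⟨
      a + (b + - c + - d)      ≈⟨ +-congˡ (+-congʳ (+-comm b _)) ⟩
      a + (- c + b + - d)      ≈⟨ +-congˡ (+-assoc _ b _) ⟩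
      a + (- c + (b + - d))    ≈⟨ +-assoc a _ _ ⟨
      (a - c) + (b - d)        ∎

    swap* : ∀ x t y → x * (t * y) ≈ t * (x * y)
    swap* x t y = begin
      x * (t * y) ≈⟨ *-assoc x t y ⟨
      (x * t) * y ≈⟨ *-congʳ (*-comm x t) ⟩
      (t * x) * y ≈⟨ *-assoc t x y ⟩
      t * (x * y) ∎

    det-⊕· : ∀ a b t c → det a (b ⊕ t · c) ≈ det a b + t * det a c
    det-⊕· (x , y) (bx , by) t (cx , cy) = begin
      x * (by + t * cy) - y * (bx + t * cx)
        ≈⟨ +-cong (distribˡ x _ _) (-‿cong (distribˡ y _ _)) ⟩
      (x * by + x * (t * cy)) - (y * bx + y * (t * cx))
        ≈⟨ interchange _ _ _ _ ⟩
      (x * by - y * bx) + (x * (t * cy) - y * (t * cx))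
        ≈⟨ +-congˡ (+-cong (swap* x t cy) (-‿cong (swap* y t cx))) ⟩
      (x * by - y * bx) + (t * (x * cy) - t * (y * cx))
        ≈⟨ +-congˡ (+-congˡ (-‿distribʳ-* t _)) ⟩
      (x * by - y * bx) + (t * (x * cy) + t * - (y * cx))
        ≈⟨ +-congˡ (distribˡ t _ _) ⟨
      (x * by - y * bx) + t * (x * cy - y * cx) ∎

    det-self : ∀ a → det a a ≈ 0#
    det-self (x , y) = trans (+-congˡ (-‿cong (*-comm y x))) (-‿inverseʳ (x * y))

    det-congʳ : ∀ a {b c} → b ≈ₚ c → det a b ≈ det a c
    det-congʳ (x , y) (p , q) = +-cong (*-congˡ q) (-‿cong (*-congˡ p))

    det-anti : ∀ a b → det a b ≈ - det b a
    det-anti (x , y) (z , w) = begin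
      x * w - y * z        ≈⟨ +-cong (*-comm x w) (-‿cong (*-comm y z)) ⟩
      w * x - z * y        ≈⟨ +-comm _ _ ⟩
      - (z * y) + w * x    ≈⟨ +-congˡ (-‿involutive (w * x)) ⟨
      - (z * y) - - (w * x) ≈⟨ -‿+-comm _ _ ⟩
      - (z * y - w * x)    ∎

    solveFor : ∀ {x y t d i} → d * i ≈ 1# → x + t * d ≈ y → t ≈ (y - x) * i
    solveFor {x} {y} {t} {d} {i} di e = begin
      t                       ≈⟨ *-identityʳ t ⟨
      t * 1#                  ≈⟨ *-congˡ di ⟨
      t * (d * i)             ≈⟨ *-assoc t d i ⟨
      (t * d) * i             ≈⟨ *-congʳ (+-identityʳ _) ⟨
      (t * d + 0#) * i        ≈⟨ *-congʳ (+-congˡ (-‿inverseʳ x)) ⟨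
      (t * d + (x - x)) * i   ≈⟨ *-congʳ (+-assoc _ _ _) ⟨
      ((t * d + x) - x) * i   ≈⟨ *-congʳ (+-congʳ (trans (+-comm _ _) e)) ⟩
      (y - x) * i             ∎

    eliminate : ∀ a b c {t u p q} → b ⊕ t · p ≈ₚ c ⊕ u · q → det a q ≈ 0# →
                det a b + t * det a p ≈ det a c
    eliminate a b c {t} {u} {p} {q} e z = begin
      det a b + t * det a p   ≈⟨ det-⊕· a b t p ⟨
      det a (b ⊕ t · p)       ≈⟨ det-congʳ a e ⟩
      det a (c ⊕ u · q)       ≈⟨ det-⊕· a c u q ⟩
      det a c + u * det a q   ≈⟨ +-congˡ (trans (*-congˡ z) (zeroʳ u)) ⟩
      det a c + 0#            ≈⟨ +-identityʳ _ ⟩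
      det a c                 ∎

    symₚ : ∀ {a b} → a ≈ₚ b → b ≈ₚ a
    symₚ (p , q) = sym p , sym q

    _≤?_ : ∀ x y → Dec (x ≤ y)
    x ≤? y = (x <? y) ⊎-dec (x ≟ y)

    open IsStrictTotalOrder isStrictTotalOrder using (<-resp-≈)

    <-respˡ : ∀ {x y z} → y ≈ z → y < x → z < x
    <-respˡ = proj₂ <-resp-≈

    <-respʳ : ∀ {x y z} → y ≈ z → x < y → x < z
    <-respʳ = proj₁ <-resp-≈

    ≤-respˡ : ∀ {x y z} → y ≈ z → y ≤ x → z ≤ x
    ≤-respˡ e (inj₁ p) = inj₁ (<-respˡ e p)
    ≤-respˡ e (inj₂ p) = inj₂ (trans (sym e) p)

    ≤-respʳ : ∀ {x y z} → y ≈ z → x ≤ y → x ≤ z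
    ≤-respʳ e (inj₁ p) = inj₁ (<-respʳ e p)
    ≤-respʳ e (inj₂ p) = inj₂ (trans p e)

  -- When the directions are not parallel, t and u are determined by
  -- Cramer's rule, so it suffices to test these values.
  meets? : ∀ l b p q → ¬ det l (q ⊖ p) ≈ 0# → Dec (Meets l b p q)
  meets? l b p q transverse = decide
    where
    v : Point
    v = q ⊖ p

    d⁻¹ : ∃[ i ] det l v * i ≈ 1#
    d⁻¹ = inverse transverse

    e⁻¹ : ∃[ i ] det v l * i ≈ 1#
    e⁻¹ = inverse λ z → transverse
      (trans (det-anti l v) (trans (-‿cong z) -0#≈0#))

    t₀ u₀ : Carrier
    t₀ = (det v p - det v b) * proj₁ e⁻¹
    u₀ = (det l b - det l p) * proj₁ d⁻¹

    unique : ∀ {t u} → b ⊕ t · l ≈ₚ p ⊕ u · v → t ≈ t₀ × u ≈ u₀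
    unique {t} {u} e =
      solveFor (proj₂ e⁻¹) (eliminate v b p {t} {u} e (det-self v)) ,
      solveFor (proj₂ d⁻¹) (eliminate l p b {u} {t} (symₚ {b ⊕ t · l} {p ⊕ u · v} e) (det-self l))

    substitute : ∀ {t u} → t ≈ t₀ → u ≈ u₀ →
                 b ⊕ t · l ≈ₚ p ⊕ u · v → b ⊕ t₀ · l ≈ₚ p ⊕ u₀ · v
    substitute te ue (e₁ , e₂) = move e₁ , move e₂
      where
      move : ∀ {x y z w} → x + _ * y ≈ z + _ * w → x + t₀ * y ≈ z + u₀ * w
      move e = trans (+-congˡ (*-congʳ (sym te))) (trans e (+-congˡ (*-congʳ ue)))

    decide : Dec (Meets l b p q)
    decide with (0# <? t₀) ×-dec (0# ≤? u₀) ×-dec (u₀ ≤? 1#) ×-dec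
                ((_ ≟ _) ×-dec (_ ≟ _))
    ... | yes (a , c , d , e) = yes (t₀ , u₀ , a , c , d , e)
    ... | no ¬m = no λ { (t , u , a , c , d , e) →
            let te , ue = unique {t} {u} e in
            ¬m ( <-respʳ te a , ≤-respʳ ue c , ≤-respˡ ue d
               , substitute te ue e) }

------------------------------------------------------------------------

data Colour : Set where
  black white : Colour

-- A directed graph with n boundary vertices, m internal vertices and k edges;
-- b_1, ..., b_n are indexed by Fin n from zero.
record Digraph (n m k : ℕ) : Set where
  Vertex : Set
  Vertex = Fin n ⊎ Fin m

  Edge : Set
  Edge = Fin k

  field
    src tgt : Edge → Vertex

  boundary : Fin n → Vertex
  boundary = inj₁

  internal : Fin m → Vertex
  internal = inj₂

  _≟ᵥ_ : DecidableEquality Vertex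
  _≟ᵥ_ = Sum.≡-dec Fin._≟_ Fin._≟_

  indegree outdegree degree : Vertex → ℕ
  indegree  v = length (filter (λ e → tgt e ≟ᵥ v) (allFin k))
  outdegree v = length (filter (λ e → src e ≟ᵥ v) (allFin k))
  degree    v = indegree v ℕ.+ outdegree v

  -- Indices of the boundary sources, for boundary vertices of degree 1.
  sources : List (Fin n)
  sources = filter (λ i → outdegree (boundary i) ℕ.≟ 1) (allFin n)

  Perfect : Colour → Vertex → Set
  Perfect white v = indegree v ≡ 1
  Perfect black v = outdegree v ≡ 1

  Adjacent : Rel Vertex 0ℓ
  Adjacent u v = ∃[ e ] src e ≡ u × tgt e ≡ v

  Incident : Vertex → Edge → Set
  Incident v e = src e ≡ v ⊎ tgt e ≡ v

record IsPlanarStraightEmbedding (ℝ : Reals) {n m k : ℕ} (G : Digraph n m k)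
         (position : Digraph.Vertex G → Plane.Point ℝ) : Set where
  open Plane ℝ
  open Digraph G

  _∈edge_ : Point → Edge → Set
  x ∈edge e = x ∈[ position (src e) , position (tgt e) ]

  field
    no-loops           : ∀ e → src e ≢ tgt e
    position-injective : ∀ {u v} → position u ≈ₚ position v → u ≡ v
    vertex-on-edge     : ∀ {v e} → position v ∈edge e → Incident v e
    disjoint-edges     : ∀ {e f x} → e ≢ f → x ∈edge e → x ∈edge f →
                         ∃[ v ] x ≈ₚ position v × Incident v e × Incident v f

record PlabicNetwork (ℝ : Reals) (n m k : ℕ) : Set₁ where
  open Reals ℝ
  open Plane ℝ

  field
    graph : Digraph n m k
  open Digraph graph public

  field
    colour          : Fin m → Colour
    boundary-degree : ∀ i → degree (boundary i) ≡ 1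
    internal-degree : ∀ v → degree (internal v) ≡ 2 ⊎ degree (internal v) ≡ 3
    -- At a trivalent vertex this determines the colour; a bivalent vertex
    -- has one incoming and one outgoing edge whichever colour it has.
    perfect         : ∀ v → Perfect (colour v) (internal v)
    not-isolated    : ∀ v → ∃[ i ] EqClosure Adjacent v (boundary i)

    disk                : Pred Point 0ℓ
    isConvexDisk        : IsConvexDisk disk
    start finish        : Point
    start≉finish        : ¬ start ≈ₚ finish
    segment-on-boundary : ∀ {x} → x ∈[ start , finish ] → disk x × ¬ Interior disk x
    -- The disk lies to the right of the vector from start to finish, so
    -- that one goes clockwise around it from start to finish.
    clockwise           : ∀ {x} → disk x → det (finish ⊖ start) (x ⊖ start) ≤ 0#

    position          : Vertex → Point
    embedding         : IsPlanarStraightEmbedding ℝ graph position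
    internal-position : ∀ v → Interior disk (position (internal v))
    abscissa          : Fin n → Carrier
    abscissa-bounds   : ∀ i → 0# ≤ abscissa i × abscissa i ≤ 1#
    abscissa-mono     : ∀ {i j} → i Fin.< j → abscissa i < abscissa j
    boundary-position : ∀ i →
      position (boundary i) ≈ₚ start ⊕ abscissa i · (finish ⊖ start)

    weight   : Edge → Carrier
    weight>0 : ∀ e → 0# < weight e

  vector : Edge → Point
  vector e = position (tgt e) ⊖ position (src e)

record GaugeRayDirection {ℝ : Reals} {n m k : ℕ} (𝒩 : PlabicNetwork ℝ n m k) : Set where
  open Reals ℝ
  open Plane ℝ
  open PlabicNetwork 𝒩
  field
    direction     : Point
    nonzero       : ¬ direction ≈ₚ (0# , 0#)
    not-parallel  : ∀ e → ¬ det direction (vector e) ≈ 0#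
    points-inside : ∀ i → ∃[ t ] 0# < t ×
                    Interior disk (position (boundary i) ⊕ t · direction)
    avoids-internal : ∀ i v t → 0# ≤ t →
      ¬ position (internal v) ≈ₚ position (boundary i) ⊕ t · direction

------------------------------------------------------------------------

module EdgeVectors {ℝ : Reals} {n m k : ℕ} (𝒩 : PlabicNetwork ℝ n m k)
                   (𝔩 : GaugeRayDirection 𝒩) where
  open Reals ℝ
  open Plane ℝ
  open PlabicNetwork 𝒩
  open GaugeRayDirection 𝔩

  -- The gauge rays are disjoint, and each meets an edge at most once, so
  -- intersections are counted by the rays on which they lie.
  int : Edge → ℕ
  int e = length (filter meetsRayFrom? sources)
    where
    meetsRayFrom? : ∀ i → Dec (Meets direction (position (boundary i))
                                     (position (src e)) (position (tgt e)))
    meetsRayFrom? i = meets? _ _ _ _ (not-parallel e)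

  private
    agreement : ℤ → ℤ → ℤ → ℤ
    agreement +[1+ 0 ] +[1+ 0 ] +[1+ 0 ] = 1ℤ
    agreement -[1+ 0 ] -[1+ 0 ] -[1+ 0 ] = -1ℤ
    agreement _        _        _        = 0ℤ

  wind : Edge → Edge → ℤ
  wind e f = agreement (orientation (vector e) (vector f))
                       (orientation (vector e) direction)
                       (orientation direction (vector f))

  -- p is a directed path with first edge e ending at the boundary vertex j.
  data IsPath : Edge → Fin n → List Edge → Set where
    end  : ∀ {e j} → tgt e ≡ boundary j → IsPath e j (e ∷ [])
    step : ∀ {e f j p} → tgt e ≡ src f → IsPath f j (f ∷ p) → IsPath e j (e ∷ f ∷ p)

  isPath? : ∀ e j p → Dec (IsPath e j p)
  isPath? e j [] = no λ ()
  isPath? e j (x ∷ p) with e Fin.≟ x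
  ... | no e≢x = no λ { (end _) → e≢x _≡_.refl ; (step _ _) → e≢x _≡_.refl }
  isPath? e j (e ∷ []) | yes _≡_.refl with tgt e ≟ᵥ boundary j
  ... | yes q = yes (end q)
  ... | no ¬q = no λ { (end q) → ¬q q }
  isPath? e j (e ∷ f ∷ p) | yes _≡_.refl with (tgt e ≟ᵥ src f) ×-dec isPath? f j (f ∷ p)
  ... | yes (q , r) = yes (step q r)
  ... | no ¬qr = no λ { (step q r) → ¬qr (q , r) }

  edgeSequences : ℕ → List (List Edge)
  edgeSequences zero    = [] ∷ []
  edgeSequences (suc L) = concatMap (λ e → map (e ∷_) (edgeSequences L)) (allFin k)

  -- All directed paths e → b_j having L edges.
  paths : ℕ → Edge → Fin n → List (List Edge)
  paths L e j = filter (isPath? e j) (edgeSequences L)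

  windPath : List Edge → ℤ
  windPath []          = 0ℤ
  windPath (e ∷ [])    = 0ℤ
  windPath (e ∷ f ∷ p) = wind e f ℤ.+ windPath (f ∷ p)

  intPath : List Edge → ℕ
  intPath []      = 0
  intPath (e ∷ p) = int e ℕ.+ intPath p

  signPath : List Edge → Carrier
  signPath p = -1^ (windPath p ℤ.+ + intPath p)

  weightPath : List Edge → Carrier
  weightPath = ∏ weight

  -- The edge vector as a vector of formal power series, with one
  -- indeterminate for the weight of each edge.

  Exponent : Set
  Exponent = Vec ℕ k

  PowerSeries : Set
  PowerSeries = Exponent → Carrier

  infix  4 _≐_
  infixl 6 _⊞_
  infixr 7 _⊙_ 𝓌_⊛_

  _≐_ : Rel PowerSeries 0ℓ
  F ≐ G = ∀ α → F α ≈ G α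

  _⊞_ : PowerSeries → PowerSeries → PowerSeries
  (F ⊞ G) α = F α + G α

  _⊙_ : Carrier → PowerSeries → PowerSeries
  (c ⊙ F) α = c * F α

  -- Multiplication by the indeterminate of the edge e.
  𝓌_⊛_ : Edge → PowerSeries → PowerSeries
  (𝓌 e ⊛ F) α with Vec.lookup α e
  ... | zero  = 0#
  ... | suc a = F (α Vec.[ e ]≔ a)

  monomial : List Edge → Exponent
  monomial p = Vec.tabulate λ e → length (filter (e Fin.≟_) p)

  -- A path contributes to the coefficient of the monomial given by its
  -- edges; the number of its edges is the total degree of that monomial.
  E : Edge → Fin n → PowerSeries
  E e j α = ∑ signPath (filter (λ p → Vec.≡-dec ℕ._≟_ (monomial p) α)
                               (paths (Vec.sum α) e j))

  -- The edge vector as a real vector: E⟨ e , j ⟩≔ x says that x is the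
  -- sum over all paths e → b_j at the given weights.  Infinite sums are
  -- taken in order of the number of edges, which gives the value of the
  -- power series wherever it converges absolutely; finite sums are covered,
  -- their partial sums being eventually constant.

  partialSum : Edge → Fin n → ℕ → Carrier
  partialSum e j N = ∑ (λ p → signPath p * weightPath p)
                       (concatMap (λ L → paths L e j) (upTo (suc N)))

  E⟨_,_⟩≔_ : Edge → Fin n → Carrier → Set
  E⟨ e , j ⟩≔ x = partialSum e j ⟶ x

{-# OPTIONS --safe #-}

-- Deleting the first edge e of a path to b_j of length L + 1 gives a path of
-- length L that starts at an edge f leaving the end of e, and this is a
-- bijection.  It divides the sign by (-1)^(int e + wind (e, f)) and the weight
-- by w_e, so the relations hold for the homogeneous parts of the edge vectors,
-- hence coefficientwise, hence for the partial sums and their limits.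

module Submission where

open import Defs
open import Data.Fin using (Fin)
open import Data.Integer using (+_) renaming (_+_ to _+ℤ_)
open import Data.Nat using (ℕ)
open import Data.Product using (_×_)
open import Relation.Binary.PropositionalEquality using (_≡_; _≢_)

open import Level using (0ℓ)
open import Algebra.Bundles using (CommutativeMonoid)
import Algebra.Properties.CommutativeSemigroup as CommutativeSemigroupProperties
import Algebra.Properties.Ring as RingProperties
import Algebra.Properties.Semiring.Exp as Exp
open import Data.Bool using (true; false; if_then_else_)
open import Data.Empty using (⊥; ⊥-elim)
import Data.Fin.Properties as Fin
open import Data.Integer as ℤ using (-[1+_]; _⊖_)
import Data.Integer.Properties as ℤ
open import Data.List using (List; []; _∷_; _++_; map; concatMap; filter; length; allFin; upTo)
import Data.List.Properties as List
open import Data.List.Membership.Propositional using (_∈_)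
open import Data.List.Membership.Propositional.Properties using (∈-allFin; ∈-filter⁺)
open import Data.List.Relation.Unary.All as All using (All; []; _∷_)
open import Data.List.Relation.Unary.All.Properties using (all-filter)
open import Data.List.Relation.Unary.AllPairs using (_∷_)
open import Data.List.Relation.Unary.Any using (here; there)
open import Data.List.Relation.Unary.Unique.Propositional using (Unique)
open import Data.List.Relation.Unary.Unique.Propositional.Properties using (allFin⁺)
open import Data.Nat as ℕ using (zero; suc; _⊔_)
import Data.Nat.Properties as ℕ
open import Data.Product using (∃-syntax; _,_; proj₁; proj₂)
open import Data.Sum using (_⊎_; inj₁; inj₂; [_,_]′)
open import Data.Vec as Vec using (Vec; []; _∷_; _[_]≔_)
import Data.Vec.Properties as Vec
open import Function using (_∘_; _$_)
open import Relation.Binary.Bundles using (StrictPartialOrder)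
open import Relation.Binary.Definitions using (tri<; tri≈; tri>)
import Relation.Binary.PropositionalEquality as ≡
import Relation.Binary.Reasoning.Setoid as SetoidReasoning
import Relation.Binary.Reasoning.StrictPartialOrder as StrictPartialOrderReasoning
open import Relation.Binary.Structures using (IsStrictTotalOrder)
open import Relation.Nullary using (¬_; Dec; yes; no; does)
open import Relation.Unary using (Pred; Decidable)

-- Lists and vectors

module _ {A B : Set} where

  filter-map : ∀ {P : Pred B 0ℓ} (P? : Decidable P) (f : A → B) xs →
               filter P? (map f xs) ≡ map f (filter (P? ∘ f) xs)
  filter-map P? f [] = ≡.refl
  filter-map P? f (x ∷ xs) with does (P? (f x))
  ... | true  = ≡.cong (f x ∷_) (filter-map P? f xs)
  ... | false = filter-map P? f xs

  filter-concatMap : ∀ {P : Pred B 0ℓ} (P? : Decidable P) (F : A → List B) xs →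
                     filter P? (concatMap F xs) ≡ concatMap (filter P? ∘ F) xs
  filter-concatMap P? F [] = ≡.refl
  filter-concatMap P? F (x ∷ xs) =
    ≡.trans (List.filter-++ P? (F x) (concatMap F xs))
            (≡.cong (filter P? (F x) ++_) (filter-concatMap P? F xs))

  concatMap-empty : ∀ (F : A → List B) {xs} → All (λ x → F x ≡ []) xs →
                    concatMap F xs ≡ []
  concatMap-empty F [] = ≡.refl
  concatMap-empty F (e ∷ es) = ≡.cong₂ _++_ e (concatMap-empty F es)

  -- Absence of repetitions makes `F x` appear exactly once. With `xs` the list of all edges, this
  -- isolates the sequences that begin with a prescribed edge.
  concatMap-single : ∀ (F : A → List B) {x xs} → Unique xs → x ∈ xs →
                     (∀ {y} → x ≢ y → F y ≡ []) → concatMap F xs ≡ F x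
  concatMap-single F {x} (x≢ ∷ _) (here ≡.refl) empty =
    ≡.trans (≡.cong (F x ++_) (concatMap-empty F (All.map empty x≢)))
            (List.++-identityʳ (F x))
  concatMap-single F (y≢ ∷ u) (there x∈) empty =
    ≡.cong₂ _++_ (empty (All.lookup y≢ x∈ ∘ ≡.sym)) (concatMap-single F u x∈ empty)

module _ {A : Set} where

  -- Degrees are lengths of filtered lists of edges; this and the next lemma turn an out-degree into
  -- a statement about which edges leave a vertex.
  length≡1⇒≡ : ∀ {xs : List A} {x y} → length xs ≡ 1 → x ∈ xs → y ∈ xs → y ≡ x
  length≡1⇒≡ {_ ∷ []} _ (here ≡.refl) (here ≡.refl) = ≡.refl

  -- Distinct members occupy both positions of the list, so the position of `z` is already taken by
  -- `x` or by `y`.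
  length≡2⇒≡⊎≡ : ∀ {xs : List A} {x y z} → length xs ≡ 2 → x ∈ xs → y ∈ xs → x ≢ y →
                 z ∈ xs → z ≡ x ⊎ z ≡ y
  length≡2⇒≡⊎≡ {_ ∷ _ ∷ []} _ (here x)         (here y)         x≢y _ =
    ⊥-elim (x≢y (≡.trans x (≡.sym y)))
  length≡2⇒≡⊎≡ {_ ∷ _ ∷ []} _ (there (here x)) (there (here y)) x≢y _ =
    ⊥-elim (x≢y (≡.trans x (≡.sym y)))
  length≡2⇒≡⊎≡ {_ ∷ _ ∷ []} _ (here x)         _ _ (here z)         = inj₁ (≡.trans z (≡.sym x))
  length≡2⇒≡⊎≡ {_ ∷ _ ∷ []} _ _         (here y) _ (here z)         = inj₂ (≡.trans z (≡.sym y))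
  length≡2⇒≡⊎≡ {_ ∷ _ ∷ []} _ (there (here x)) _ _ (there (here z)) = inj₁ (≡.trans z (≡.sym x))
  length≡2⇒≡⊎≡ {_ ∷ _ ∷ []} _ _ (there (here y)) _ (there (here z)) = inj₂ (≡.trans z (≡.sym y))

-- The total degree of an exponent is the length of the contributing paths, so lowering one entry by
-- one matches the loss of one edge.
sum-≔ : ∀ {k} (α : Vec ℕ k) e {a} → Vec.lookup α e ≡ suc a →
        Vec.sum α ≡ suc (Vec.sum (α [ e ]≔ a))
sum-≔ (x ∷ α) Fin.zero    ≡.refl = ≡.refl
sum-≔ (x ∷ α) (Fin.suc e) {a} eq =
  ≡.trans (≡.cong (x ℕ.+_) (sum-≔ α e eq)) (ℕ.+-suc x (Vec.sum (α [ e ]≔ a)))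

tabulate-updateAt : ∀ {k} {A : Set} {f g : Fin k → A} (h : A → A) e →
                    g e ≡ h (f e) → (∀ {x} → x ≢ e → g x ≡ f x) →
                    Vec.tabulate g ≡ Vec.updateAt (Vec.tabulate f) e h
tabulate-updateAt h Fin.zero    eq neq =
  ≡.cong₂ _∷_ eq (Vec.tabulate-cong λ x → neq {Fin.suc x} λ ())
tabulate-updateAt h (Fin.suc e) eq neq =
  ≡.cong₂ _∷_ (neq {Fin.zero} λ ())
    (tabulate-updateAt h e eq λ x≢e → neq (x≢e ∘ Fin.suc-injective))

-- Signs and sums

module RealProperties (ℝ : Reals) where
  open Reals ℝ
  open RingProperties ring
  open Exp semiring using (^-homo-*)
  open CommutativeSemigroupProperties *-commutativeSemigroup
    using () renaming (interchange to *-interchange)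
  open CommutativeSemigroupProperties (CommutativeMonoid.commutativeSemigroup +-commutativeMonoid)
    using (x∙yz≈y∙xz) renaming (interchange to +-interchange)
  open SetoidReasoning setoid

  -1*-1≈1 : - 1# * - 1# ≈ 1#
  -1*-1≈1 = trans (-1*x≈-x (- 1#)) (-‿involutive 1#)

  -- The definition of `-1^_` uses the absolute value, which is not additive on opposite signs.
  -- Cancelling a successor on both sides of `⊖` costs a factor `- 1# * - 1#`, which is one.
  -1^-⊖ : ∀ m n → -1^ (m ⊖ n) ≈ (- 1#) ^ m * (- 1#) ^ n
  -1^-⊖ m       zero    = sym (*-identityʳ _)
  -1^-⊖ zero    (suc n) = sym (*-identityˡ _)
  -1^-⊖ (suc m) (suc n) = begin
    -1^ (suc m ⊖ suc n)                               ≡⟨ ≡.cong -1^_ (ℤ.[1+m]⊖[1+n]≡m⊖n m n) ⟩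
    -1^ (m ⊖ n)                                       ≈⟨ -1^-⊖ m n ⟩
    (- 1#) ^ m * (- 1#) ^ n                           ≈⟨ *-identityˡ _ ⟨
    1# * ((- 1#) ^ m * (- 1#) ^ n)                    ≈⟨ *-congʳ -1*-1≈1 ⟨
    (- 1# * - 1#) * ((- 1#) ^ m * (- 1#) ^ n)         ≈⟨ *-interchange _ _ _ _ ⟩
    (- 1#) ^ suc m * (- 1#) ^ suc n                   ∎

  -1^-homo : ∀ a b → -1^ (a ℤ.+ b) ≈ -1^ a * -1^ b
  -1^-homo (+ m)    (+ n)    = ^-homo-* (- 1#) m n
  -1^-homo (+ m)    -[1+ n ] = -1^-⊖ m (suc n)
  -1^-homo -[1+ m ] (+ n)    = trans (-1^-⊖ n (suc m)) (*-comm _ _)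
  -1^-homo -[1+ m ] -[1+ n ] = begin
    (- 1#) ^ suc (suc m ℕ.+ n)      ≡⟨ ≡.cong ((- 1#) ^_) (ℕ.+-suc (suc m) n) ⟨
    (- 1#) ^ (suc m ℕ.+ suc n)      ≈⟨ ^-homo-* (- 1#) (suc m) (suc n) ⟩
    (- 1#) ^ suc m * (- 1#) ^ suc n ∎

  if-dec-* : ∀ {P Q : Set} {x c y} (P? : Dec P) (Q? : Dec Q) → (P → Q) → (Q → P) →
             x ≈ c * y →
             (if does P? then x else 0#) ≈ c * (if does Q? then y else 0#)
  if-dec-* (yes _) (yes _) _  _    e = e
  if-dec-* (yes p) (no ¬q) to _    _ = ⊥-elim (¬q (to p))
  if-dec-* (no ¬p) (yes q) _  from _ = ⊥-elim (¬p (from q))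
  if-dec-* (no _)  (no _)  _  _    _ = sym (zeroʳ _)

  module _ {A : Set} where

    ∑-map : ∀ {B : Set} (f : A → Carrier) (g : B → A) xs → ∑ f (map g xs) ≡ ∑ (f ∘ g) xs
    ∑-map f g []       = ≡.refl
    ∑-map f g (x ∷ xs) = ≡.cong (_+_ (f (g x))) (∑-map f g xs)

    ∑-congᴬ : ∀ (f g : A → Carrier) {xs} → All (λ x → f x ≈ g x) xs → ∑ f xs ≈ ∑ g xs
    ∑-congᴬ f g []       = refl
    ∑-congᴬ f g (e ∷ es) = +-cong e (∑-congᴬ f g es)

    ∑-cong : ∀ (f g : A → Carrier) → (∀ x → f x ≈ g x) → ∀ xs → ∑ f xs ≈ ∑ g xs
    ∑-cong f g e xs = ∑-congᴬ f g (All.universal e xs)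

    ∑-++ : ∀ (f : A → Carrier) xs ys → ∑ f (xs ++ ys) ≈ ∑ f xs + ∑ f ys
    ∑-++ f []       ys = sym (+-identityˡ _)
    ∑-++ f (x ∷ xs) ys = trans (+-congˡ (∑-++ f xs ys)) (sym (+-assoc _ _ _))

    ∑-+ : ∀ (f g : A → Carrier) xs → ∑ (λ x → f x + g x) xs ≈ ∑ f xs + ∑ g xs
    ∑-+ f g []       = sym (+-identityˡ _)
    ∑-+ f g (x ∷ xs) = trans (+-congˡ (∑-+ f g xs)) (+-interchange _ _ _ _)

    ∑-* : ∀ c (f : A → Carrier) xs → ∑ (λ x → c * f x) xs ≈ c * ∑ f xs
    ∑-* c f []       = sym (zeroʳ c)
    ∑-* c f (x ∷ xs) = trans (+-congˡ (∑-* c f xs)) (sym (distribˡ _ _ _))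

    ∑-concatMap : ∀ {B : Set} (f : A → Carrier) (F : B → List A) xs →
                  ∑ f (concatMap F xs) ≈ ∑ (λ x → ∑ f (F x)) xs
    ∑-concatMap f F []       = refl
    ∑-concatMap f F (x ∷ xs) = trans (∑-++ f (F x) _) (+-congˡ (∑-concatMap f F xs))

    ∑-filter : ∀ {P : Pred A 0ℓ} (P? : Decidable P) (f : A → Carrier) xs →
               ∑ f (filter P? xs) ≈ ∑ (λ x → if does (P? x) then f x else 0#) xs
    ∑-filter P? f [] = refl
    ∑-filter P? f (x ∷ xs) with does (P? x)
    ... | true  = +-congˡ (∑-filter P? f xs)
    ... | false = trans (∑-filter P? f xs) (sym (+-identityˡ _))

    -- Serves to split the paths through a vertex by their second edge. Induction on the list keeps
    -- the order of summands in each part, and commutativity is used when the head belongs to `R`.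
    ∑-filter-⊎ : ∀ {P Q R : Pred A 0ℓ} (P? : Decidable P) (Q? : Decidable Q) (R? : Decidable R) →
                 (∀ {x} → P x → Q x ⊎ R x) → (∀ {x} → Q x → P x) → (∀ {x} → R x → P x) →
                 (∀ {x} → Q x → R x → ⊥) →
                 ∀ (f : A → Carrier) xs →
                 ∑ f (filter P? xs) ≈ ∑ f (filter Q? xs) + ∑ f (filter R? xs)
    ∑-filter-⊎ P? Q? R? split Q⊆P R⊆P disjoint f [] = sym (+-identityˡ _)
    ∑-filter-⊎ P? Q? R? split Q⊆P R⊆P disjoint f (x ∷ xs)
      with ih ← ∑-filter-⊎ P? Q? R? split Q⊆P R⊆P disjoint f xs | P? x | Q? x | R? x
    ... | _     | yes q | yes r = ⊥-elim (disjoint q r)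
    ... | yes _ | yes _ | no _  = trans (+-congˡ ih) (sym (+-assoc _ _ _))
    ... | yes _ | no _  | yes _ = trans (+-congˡ ih) (x∙yz≈y∙xz _ _ _)
    ... | yes p | no ¬q | no ¬r = ⊥-elim ([ ¬q , ¬r ]′ (split p))
    ... | no ¬p | yes q | no _  = ⊥-elim (¬p (Q⊆P q))
    ... | no ¬p | no _  | yes r = ⊥-elim (¬p (R⊆P r))
    ... | no _  | no _  | no _  = ih

-- Limits of real sequences

module Limits (ℝ : Reals) where
  open Reals ℝ
  open RingProperties ring
  open CommutativeSemigroupProperties (CommutativeMonoid.commutativeSemigroup +-commutativeMonoid)
    using (interchange)
  open IsStrictTotalOrder isStrictTotalOrder
    using (isStrictPartialOrder; irrefl; <-resp-≈; asym) renaming (trans to <-trans)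

  strictPartialOrder : StrictPartialOrder 0ℓ 0ℓ 0ℓ
  strictPartialOrder = record { isStrictPartialOrder = isStrictPartialOrder }

  open StrictPartialOrderReasoning strictPartialOrder

  <-resp₂ : ∀ {x x′ y y′} → x ≈ x′ → y ≈ y′ → x < y → x′ < y′
  <-resp₂ ex ey = proj₂ <-resp-≈ ex ∘ proj₁ <-resp-≈ ey

  +-mono-< : ∀ {x y u v} → x < y → u < v → x + u < y + v
  +-mono-< {x} {y} {u} {v} x<y u<v = begin-strict
    x + u <⟨ +-monoˡ-< x u<v ⟩
    x + v ≈⟨ +-comm x v ⟩
    v + x <⟨ +-monoˡ-< v x<y ⟩
    v + y ≈⟨ +-comm v y ⟩
    y + v ∎

  x-y+y≈x : ∀ x y → x - y + y ≈ x
  x-y+y≈x x y = begin-equality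
    x - y + y     ≈⟨ +-assoc x (- y) y ⟩
    x + (- y + y) ≈⟨ +-congˡ (-‿inverseˡ y) ⟩
    x + 0#        ≈⟨ +-identityʳ x ⟩
    x             ∎

  x<y⇒0<y-x : ∀ {x y} → x < y → 0# < y - x
  x<y⇒0<y-x {x} {y} x<y = begin-strict
    0#      ≈⟨ -‿inverseˡ x ⟨
    - x + x <⟨ +-monoˡ-< (- x) x<y ⟩
    - x + y ≈⟨ +-comm (- x) y ⟩
    y - x   ∎

  0<y-x⇒x<y : ∀ {x y} → 0# < y - x → x < y
  0<y-x⇒x<y {x} {y} 0<y-x = begin-strict
    x           ≈⟨ +-identityʳ x ⟨
    x + 0#      <⟨ +-monoˡ-< x 0<y-x ⟩
    x + (y - x) ≈⟨ +-comm x _ ⟩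
    y - x + x   ≈⟨ x-y+y≈x y x ⟩
    y           ∎

  neg-mono-< : ∀ {x y} → x < y → - y < - x
  neg-mono-< {x} {y} x<y = 0<y-x⇒x<y $ begin-strict
    0#        <⟨ x<y⇒0<y-x x<y ⟩
    y - x     ≈⟨ +-comm y (- x) ⟩
    - x + y   ≈⟨ +-congˡ (-‿involutive y) ⟨
    - x - - y ∎

  x<0⇒0<-x : ∀ {x} → x < 0# → 0# < - x
  x<0⇒0<-x = <-resp₂ -0#≈0# refl ∘ neg-mono-<

  *-monoʳ-< : ∀ {c x y} → 0# < c → x < y → c * x < c * y
  *-monoʳ-< {c} {x} {y} 0<c x<y = 0<y-x⇒x<y $
    <-resp₂ refl (x[y-z]≈xy-xz c y x) (*-pos 0<c (x<y⇒0<y-x x<y))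

  0<1 : 0# < 1#
  0<1 with compare 0# 1#
  ... | tri< 0<1 _ _ = 0<1
  ... | tri≈ _ 0≈1 _ = ⊥-elim (0≉1 0≈1)
  -- If `1#` were negative, `- 1#` would be positive, and so would be its square, which is `1#`.
  ... | tri> _ _ 1<0 = <-resp₂ refl -1*-1≈1 (*-pos (x<0⇒0<-x 1<0) (x<0⇒0<-x 1<0))
    where open RealProperties ℝ using (-1*-1≈1)

  -- The field axiom gives an inverse without a sign. A zero inverse would make `0# ≈ 1#`, and a
  -- negative one would make `1# < 0#`.
  positive-inverse : ∀ {x} → 0# < x → ∃[ y ] 0# < y × x * y ≈ 1#
  positive-inverse {x} 0<x with inverse (λ x≈0 → irrefl (sym x≈0) 0<x)
  ... | y , xy≈1 with compare 0# y
  ...   | tri< 0<y _ _ = y , 0<y , xy≈1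
  ...   | tri≈ _ 0≈y _ = ⊥-elim (0≉1 (trans (sym (zeroʳ x)) (trans (*-congˡ 0≈y) xy≈1)))
  ...   | tri> _ _ y<0 =
    ⊥-elim (asym 0<1 (<-resp₂ xy≈1 (zeroʳ x) (*-monoʳ-< 0<x y<0)))

  half : ∀ {ε} → 0# < ε → ∃[ δ ] 0# < δ × δ + δ ≈ ε
  half {ε} 0<ε =
    let i , 0<i , 2i≈1 = positive-inverse 0<2 in
    i * ε , *-pos 0<i 0<ε , (begin-equality
      i * ε + i * ε           ≈⟨ distribʳ ε i i ⟨
      (i + i) * ε             ≈⟨ *-congʳ (+-cong (*-identityˡ i) (*-identityˡ i)) ⟨
      (1# * i + 1# * i) * ε   ≈⟨ *-congʳ (distribʳ i 1# 1#) ⟨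
      ((1# + 1#) * i) * ε     ≈⟨ *-congʳ 2i≈1 ⟩
      1# * ε                  ≈⟨ *-identityˡ ε ⟩
      ε                       ∎)
    where
    0<2 : 0# < 1# + 1#
    0<2 = <-resp₂ (+-identityˡ 0#) refl (+-mono-< 0<1 0<1)

  -- The condition that `_⟶_` imposes on `s M - x`, playing the part of a bound on an absolute
  -- value.
  Small : Carrier → Carrier → Set
  Small ε x = - ε < x × x < ε

  Small-resp : ∀ {ε δ x y} → ε ≈ δ → x ≈ y → Small ε x → Small δ y
  Small-resp ε≈δ x≈y (l , u) = <-resp₂ (-‿cong ε≈δ) x≈y l , <-resp₂ x≈y ε≈δ u

  Small-+ : ∀ {ε δ x y} → Small ε x → Small δ y → Small (ε + δ) (x + y)
  Small-+ (l , u) (l′ , u′) = <-resp₂ (-‿+-comm _ _) refl (+-mono-< l l′) , +-mono-< u u′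

  Small-neg : ∀ {ε x} → Small ε x → Small ε (- x)
  Small-neg (l , u) = neg-mono-< u , <-resp₂ refl (-‿involutive _) (neg-mono-< l)

  Small-* : ∀ {c ε x} → 0# < c → Small ε x → Small (c * ε) (c * x)
  Small-* 0<c (l , u) =
    <-resp₂ (sym (-‿distribʳ-* _ _)) refl (*-monoʳ-< 0<c l) , *-monoʳ-< 0<c u

  0-Small : ∀ {ε} → 0# < ε → Small ε 0#
  0-Small 0<ε = <-resp₂ refl -0#≈0# (neg-mono-< 0<ε) , 0<ε

  -- A nonzero `x` fails the bound whose tolerance is its own absolute value, namely `x` or `- x`.
  Small⇒≈0 : ∀ {x} → (∀ {ε} → 0# < ε → Small ε x) → x ≈ 0#
  Small⇒≈0 {x} small with compare 0# x
  ... | tri< 0<x _ _ = ⊥-elim (irrefl refl (proj₂ (small 0<x)))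
  ... | tri≈ _ 0≈x _ = sym 0≈x
  ... | tri> _ _ x<0 =
    ⊥-elim (irrefl (-‿involutive x) (proj₁ (small (x<0⇒0<-x x<0))))

  ⟶-cong : ∀ {s t x y} → (∀ N → s N ≈ t N) → x ≈ y → s ⟶ x → t ⟶ y
  ⟶-cong s≈t x≈y s⟶x ε 0<ε =
    let N , near = s⟶x ε 0<ε in
    N , λ M N≤M → Small-resp refl (+-cong (s≈t M) (-‿cong x≈y)) (near M N≤M)

  -- Needed because removing an edge relates the partial sum of `e` up to `suc N` to those of its
  -- successors up to `N`.
  ⟶-suc : ∀ {s x} → s ⟶ x → (s ∘ suc) ⟶ x
  ⟶-suc s⟶x ε 0<ε =
    let N , near = s⟶x ε 0<ε in N , λ M N≤M → near (suc M) (ℕ.m≤n⇒m≤1+n N≤M)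

  ⟶-+ : ∀ {s t x y} → s ⟶ x → t ⟶ y → (λ N → s N + t N) ⟶ (x + y)
  ⟶-+ {s} {t} {x} {y} s⟶x t⟶y ε 0<ε =
    let δ , 0<δ , δ+δ≈ε = half 0<ε
        N , near = s⟶x δ 0<δ
        N′ , near′ = t⟶y δ 0<δ
    in
    N ⊔ N′ , λ M N⊔N′≤M → Small-resp δ+δ≈ε
      (trans (interchange _ _ _ _) (+-congˡ (-‿+-comm x y)))
      (Small-+ (near M (ℕ.m⊔n≤o⇒m≤o N N′ N⊔N′≤M)) (near′ M (ℕ.m⊔n≤o⇒n≤o N N′ N⊔N′≤M)))

  ⟶-neg : ∀ {s x} → s ⟶ x → (λ N → - s N) ⟶ (- x)
  ⟶-neg s⟶x ε 0<ε =
    let N , near = s⟶x ε 0<ε in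
    N , λ M N≤M → Small-resp refl (sym (-‿+-comm _ _)) (Small-neg (near M N≤M))

  ⟶-*-positive : ∀ {c s x} → 0# < c → s ⟶ x → (λ N → c * s N) ⟶ (c * x)
  ⟶-*-positive {c} {s} {x} 0<c s⟶x ε 0<ε =
    let i , 0<i , ci≈1 = positive-inverse 0<c
        -- With `i` the inverse of `c`, multiplication by `c` brings the tolerance `i * ε` back to
        -- `ε`.
        N , near = s⟶x (i * ε) (*-pos 0<i 0<ε)
    in
    N , λ M N≤M → Small-resp
      (trans (sym (*-assoc c i ε)) (trans (*-congʳ ci≈1) (*-identityˡ ε)))
      (x[y-z]≈xy-xz c (s M) x)
      (Small-* 0<c (near M N≤M))

  -- The factors that occur carry signs, whereas inequalities survive only positive scaling. A
  -- negative `c` is therefore handled through `- c` and a final negation; for `c` zero the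
  -- difference vanishes at every index.
  ⟶-* : ∀ c {s x} → s ⟶ x → (λ N → c * s N) ⟶ (c * x)
  ⟶-* c {s} {x} s⟶x with compare 0# c
  ... | tri< 0<c _ _ = ⟶-*-positive 0<c s⟶x
  ... | tri≈ _ 0≈c _ = λ ε 0<ε → 0 , λ M _ → Small-resp refl (0≈ M) (0-Small 0<ε)
    where
    0≈ : ∀ M → 0# ≈ c * s M - c * x
    0≈ M = begin-equality
      0#              ≈⟨ zeroˡ (s M - x) ⟨
      0# * (s M - x)  ≈⟨ *-congʳ 0≈c ⟩
      c * (s M - x)   ≈⟨ x[y-z]≈xy-xz c (s M) x ⟩
      c * s M - c * x ∎
  ... | tri> _ _ c<0 =
    ⟶-cong (λ N → neg-neg (s N)) (neg-neg x)
           (⟶-neg (⟶-*-positive (x<0⇒0<-x c<0) s⟶x))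
    where
    neg-neg : ∀ y → - (- c * y) ≈ c * y
    neg-neg y = trans (-‿cong (sym (-‿distribˡ-* c y))) (-‿involutive (c * y))

  -- The sequence `s N - s N` tends to `x - y` but is identically zero, so `x - y` is smaller than
  -- every tolerance.
  ⟶-unique : ∀ {s x y} → s ⟶ x → s ⟶ y → x ≈ y
  ⟶-unique {s} {x} {y} s⟶x s⟶y = x∙y⁻¹≈ε⇒x≈y x y $ Small⇒≈0 λ {ε} 0<ε →
    let N , near = ⟶-+ s⟶x (⟶-neg s⟶y) ε 0<ε in
    Small-resp refl (difference (s N)) (Small-neg (near N ℕ.≤-refl))
    where
    difference : ∀ z → - ((z - z) - (x - y)) ≈ x - y
    difference z = begin-equality
      - ((z - z) - (x - y)) ≈⟨ -‿cong (+-congʳ (-‿inverseʳ z)) ⟩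
      - (0# - (x - y))      ≈⟨ -‿cong (+-identityˡ _) ⟩
      - - (x - y)           ≈⟨ -‿involutive _ ⟩
      x - y                 ∎

-- Paths and edge vectors

module PathRecursion {ℝ : Reals} {n m k : ℕ} (𝒩 : PlabicNetwork ℝ n m k)
                     (𝔩 : GaugeRayDirection 𝒩) where
  open Reals ℝ
  open RealProperties ℝ
  open Limits ℝ
  open PlabicNetwork 𝒩
  open EdgeVectors 𝒩 𝔩
  open CommutativeSemigroupProperties *-commutativeSemigroup
    using () renaming (interchange to *-interchange)
  open CommutativeSemigroupProperties
    (CommutativeMonoid.commutativeSemigroup ℤ.+-0-commutativeMonoid)
    using () renaming (interchange to +ℤ-interchange)

  multiplier : Edge → Edge → Carrier
  multiplier e f = -1^ (+ int e +ℤ wind e f)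

  -- The second edge `f` must be exposed, because the winding lost with `e` depends on it.
  signPath-∷ : ∀ e f p → signPath (e ∷ f ∷ p) ≈ multiplier e f * signPath (f ∷ p)
  signPath-∷ e f p = trans (reflexive (≡.cong -1^_ exponent)) (-1^-homo (+ int e +ℤ wind e f) _)
    where
    W I : ℤ.ℤ
    W = windPath (f ∷ p)
    I = + intPath (f ∷ p)
    exponent : (wind e f +ℤ W) +ℤ (+ int e +ℤ I) ≡ (+ int e +ℤ wind e f) +ℤ (W +ℤ I)
    exponent = ≡.trans (+ℤ-interchange (wind e f) W (+ int e) I)
                       (≡.cong (_+ℤ (W +ℤ I)) (ℤ.+-comm (wind e f) (+ int e)))

  -- Paths and their tails

  IsPath-head : ∀ {e j p} → IsPath e j p → ∃[ q ] p ≡ e ∷ q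
  IsPath-head (end _)    = _ , ≡.refl
  IsPath-head (step _ _) = _ , ≡.refl

  IsPath-∷⁺ : ∀ {e f j p} → tgt e ≡ src f → IsPath f j p → IsPath e j (e ∷ p)
  IsPath-∷⁺ t r with IsPath-head r
  ... | _ , ≡.refl = step t r

  -- A path stops only at a boundary vertex, so one that has reached an internal vertex must
  -- continue.
  IsPath-∷⁻ : ∀ {e v j p} → tgt e ≡ internal v → IsPath e j (e ∷ p) →
              ∃[ f ] src f ≡ internal v × IsPath f j p
  IsPath-∷⁻ t (end t′) with () ← ≡.trans (≡.sym t) t′
  IsPath-∷⁻ t (step t′ r) = _ , ≡.trans (≡.sym t′) t , r

  -- Sequences of length `suc L` are enumerated by their first entry. The block of `x` contains no
  -- path from `e` unless `x` is `e`, and that block occurs once.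
  paths-suc : ∀ L e j → paths (suc L) e j ≡
              map (e ∷_) (filter (λ p → isPath? e j (e ∷ p)) (edgeSequences L))
  paths-suc L e j = begin
    filter (isPath? e j) (concatMap prepend (allFin k))
      ≡⟨ filter-concatMap (isPath? e j) prepend (allFin k) ⟩
    concatMap (filter (isPath? e j) ∘ prepend) (allFin k)
      ≡⟨ concatMap-single _ (allFin⁺ k) (∈-allFin e) other ⟩
    filter (isPath? e j) (prepend e)
      ≡⟨ filter-map (isPath? e j) (e ∷_) (edgeSequences L) ⟩
    map (e ∷_) (filter (λ p → isPath? e j (e ∷ p)) (edgeSequences L)) ∎
    where
    open ≡.≡-Reasoning
    prepend : Edge → List (List Edge)
    prepend x = map (x ∷_) (edgeSequences L)

    other : ∀ {x} → e ≢ x → filter (isPath? e j) (prepend x) ≡ []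
    other {x} e≢x = ≡.trans (filter-map (isPath? e j) (x ∷_) (edgeSequences L))
      (≡.cong (map (x ∷_)) (List.filter-none (λ p → isPath? e j (x ∷ p))
        (All.universal not-path (edgeSequences L))))
      where
      not-path : ∀ p → ¬ IsPath e j (x ∷ p)
      not-path p r = e≢x (≡.sym (List.∷-injectiveˡ (proj₂ (IsPath-head r))))

  ∑-paths-suc : ∀ (Φ : List Edge → Carrier) L e j → ∑ Φ (paths (suc L) e j) ≈
                ∑ (Φ ∘ (e ∷_)) (filter (λ p → isPath? e j (e ∷ p)) (edgeSequences L))
  ∑-paths-suc Φ L e j = reflexive (≡.trans (≡.cong (∑ Φ) (paths-suc L e j))
    (∑-map Φ (e ∷_) (filter (λ p → isPath? e j (e ∷ p)) (edgeSequences L))))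

  -- Comparing the summands on lists that begin with `f` suffices, since every path from `f` has
  -- that form.
  ∑-paths-* : ∀ {Φ Ψ : List Edge → Carrier} {c f} → (∀ p → Φ (f ∷ p) ≈ c * Ψ (f ∷ p)) →
              ∀ L j → ∑ Φ (paths L f j) ≈ c * ∑ Ψ (paths L f j)
  ∑-paths-* {Φ} {Ψ} {c} {f} Φ≈cΨ L j =
    trans (∑-congᴬ Φ (λ p → c * Ψ p) (All.map scale (all-filter (isPath? f j) (edgeSequences L))))
          (∑-* c Ψ (paths L f j))
    where
    scale : ∀ {p} → IsPath f j p → Φ p ≈ c * Ψ p
    scale r with IsPath-head r
    ... | p , ≡.refl = Φ≈cΨ p

  -- Coefficients of the power series

  term : Exponent → List Edge → Carrier
  term α p = if does (Vec.≡-dec ℕ._≟_ (monomial p) α) then signPath p else 0#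

  -- Moving the condition on the monomial from the list into the summand leaves a sum over all paths
  -- of one length, the form that the path recursion handles.
  E-term : ∀ e j α → E e j α ≈ ∑ (term α) (paths (Vec.sum α) e j)
  E-term e j α =
    ∑-filter (λ p → Vec.≡-dec ℕ._≟_ (monomial p) α) signPath (paths (Vec.sum α) e j)

  monomial-∷ : ∀ e p → monomial (e ∷ p) ≡ Vec.updateAt (monomial p) e suc
  monomial-∷ e p = tabulate-updateAt suc e
    (≡.cong length (List.filter-accept (e Fin.≟_) ≡.refl))
    (λ x≢e → ≡.cong length (List.filter-reject (_ Fin.≟_) x≢e))

  lookup-monomial-∷ : ∀ e p → Vec.lookup (monomial (e ∷ p)) e ≡ suc (Vec.lookup (monomial p) e)
  lookup-monomial-∷ e p =
    ≡.trans (≡.cong (λ β → Vec.lookup β e) (monomial-∷ e p)) (Vec.lookup∘updateAt e (monomial p))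

  -- Prepending `e` raises its own exponent by one and changes no other. As that exponent is `suc a`
  -- in `α`, lowering it to `a` is the exact inverse.
  monomial-∷-≔ : ∀ {α e a} p → Vec.lookup α e ≡ suc a →
                 (monomial (e ∷ p) ≡ α → monomial p ≡ α [ e ]≔ a) ×
                 (monomial p ≡ α [ e ]≔ a → monomial (e ∷ p) ≡ α)
  monomial-∷-≔ {α} {e} {a} p αₑ = to , from
    where
    open ≡.≡-Reasoning
    to : monomial (e ∷ p) ≡ α → monomial p ≡ α [ e ]≔ a
    to ≡.refl = ≡.sym (begin
      monomial (e ∷ p) [ e ]≔ a                    ≡⟨ ≡.cong (_[ e ]≔ a) (monomial-∷ e p) ⟩
      Vec.updateAt (monomial p) e suc [ e ]≔ a     ≡⟨ Vec.updateAt-updateAt e (monomial p) ⟩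
      monomial p [ e ]≔ a                          ≡⟨ Vec.updateAt-id-local e (monomial p) a≡ ⟩
      monomial p                                   ∎)
      where
      a≡ : a ≡ Vec.lookup (monomial p) e
      a≡ = ℕ.suc-injective (≡.trans (≡.sym αₑ) (lookup-monomial-∷ e p))
    from : monomial p ≡ α [ e ]≔ a → monomial (e ∷ p) ≡ α
    from eq = begin
      monomial (e ∷ p)                  ≡⟨ monomial-∷ e p ⟩
      Vec.updateAt (monomial p) e suc   ≡⟨ ≡.cong (λ β → Vec.updateAt β e suc) eq ⟩
      Vec.updateAt (α [ e ]≔ a) e suc   ≡⟨ Vec.updateAt-updateAt e α ⟩
      α [ e ]≔ suc a                    ≡⟨ Vec.updateAt-id-local e α (≡.sym αₑ) ⟩
      α                                 ∎

  term-∷ : ∀ {α e a} → Vec.lookup α e ≡ suc a → ∀ f p →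
           term α (e ∷ f ∷ p) ≈ multiplier e f * term (α [ e ]≔ a) (f ∷ p)
  term-∷ {α} {e} {a} αₑ f p =
    let to , from = monomial-∷-≔ (f ∷ p) αₑ in
    if-dec-* (Vec.≡-dec ℕ._≟_ (monomial (e ∷ f ∷ p)) α)
             (Vec.≡-dec ℕ._≟_ (monomial (f ∷ p)) (α [ e ]≔ a))
             to from (signPath-∷ e f p)

  -- Every path counted by `E e j` uses `e` at least once, as its first edge.
  E-zero : ∀ {α e} j → Vec.lookup α e ≡ 0 → E e j α ≈ 0#
  E-zero {α} {e} j αₑ = reflexive (≡.cong (∑ signPath)
    (List.filter-none (λ p → Vec.≡-dec ℕ._≟_ (monomial p) α)
      (All.map absent (all-filter (isPath? e j) (edgeSequences (Vec.sum α))))))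
    where
    absent : ∀ {p} → IsPath e j p → monomial p ≢ α
    absent r ≡.refl with IsPath-head r
    ... | p , ≡.refl with () ← ≡.trans (≡.sym αₑ) (lookup-monomial-∷ e p)

  -- Exhibits the path length `Vec.sum α` as a successor, so that the first edge can be removed.
  E-suc : ∀ {α e a} j → Vec.lookup α e ≡ suc a →
          E e j α ≈ ∑ (term α) (paths (suc (Vec.sum (α [ e ]≔ a))) e j)
  E-suc {α} {e} j αₑ = trans (E-term e j α)
    (reflexive (≡.cong (λ L → ∑ (term α) (paths L e j)) (sum-≔ α e αₑ)))

  𝓌-zero : ∀ {α e} (F : PowerSeries) → Vec.lookup α e ≡ 0 → (𝓌 e ⊛ F) α ≡ 0#
  𝓌-zero {α} {e} F αₑ with Vec.lookup α e
  ... | zero = ≡.refl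

  𝓌-suc : ∀ {α e a} (F : PowerSeries) → Vec.lookup α e ≡ suc a →
          (𝓌 e ⊛ F) α ≡ F (α [ e ]≔ a)
  𝓌-suc {α} {e} F αₑ with Vec.lookup α e
  𝓌-suc {α} {e} F ≡.refl | suc a = ≡.refl

  -- The contribution to E_e of the paths whose second edge is f.
  through : Edge → Edge → Fin n → PowerSeries
  through e f j = multiplier e f ⊙ 𝓌 e ⊛ E f j

  through-zero : ∀ {α e} f j → Vec.lookup α e ≡ 0 → through e f j α ≈ 0#
  through-zero {α} {e} f j αₑ = trans (*-congˡ (reflexive (𝓌-zero {α} (E f j) αₑ))) (zeroʳ _)

  through-suc : ∀ {α e a} f j → Vec.lookup α e ≡ suc a →
                multiplier e f * ∑ (term (α [ e ]≔ a)) (paths (Vec.sum (α [ e ]≔ a)) f j)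
                ≈ through e f j α
  through-suc {α} {e} {a} f j αₑ = *-congˡ (trans (sym (E-term f j (α [ e ]≔ a)))
    (reflexive (≡.sym (𝓌-suc {α} (E f j) αₑ))))

  -- Partial sums at the given weights

  value : List Edge → Carrier
  value p = signPath p * weightPath p

  value-∷ : ∀ e f p → value (e ∷ f ∷ p) ≈ (multiplier e f * weight e) * value (f ∷ p)
  value-∷ e f p = trans (*-congʳ (signPath-∷ e f p)) (*-interchange _ _ _ _)

  partialSum-∑ : ∀ e j N → partialSum e j N ≈ ∑ (λ L → ∑ value (paths L e j)) (upTo (suc N))
  partialSum-∑ e j N = ∑-concatMap value (λ L → paths L e j) (upTo (suc N))

  -- No path has zero edges: `paths 0 e j` computes to the empty list, so the lengths from 1 to
  -- `suc N` remain and are reindexed from 0.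
  partialSum-suc : ∀ e j N → partialSum e j (suc N) ≈
                   ∑ (λ L → ∑ value (paths (suc L) e j)) (upTo (suc N))
  partialSum-suc e j N = trans
    (reflexive (≡.cong (∑ value) (≡.trans
      (≡.cong (concatMap (λ L → paths L e j)) (≡.sym (List.map-applyUpTo (λ L → L) suc (suc N))))
      (List.concatMap-map (λ L → paths L e j) suc (upTo (suc N))))))
    (∑-concatMap value (λ L → paths (suc L) e j) (upTo (suc N)))

  partialSum-* : ∀ c f j N → ∑ (λ L → c * ∑ value (paths L f j)) (upTo (suc N)) ≈
                 c * partialSum f j N
  partialSum-* c f j N = trans (∑-* c _ (upTo (suc N))) (*-congˡ (sym (partialSum-∑ f j N)))

  -- Recursion at a vertex with one outgoing edge

  module UniqueSuccessor {v : Fin m} {e f : Edge}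
           (t : tgt e ≡ internal v) (s : src f ≡ internal v)
           (only : ∀ {h} → src h ≡ internal v → h ≡ f) (j : Fin n) where

    -- Two summands are allowed because `term` changes its exponent when `e` is removed; taking both
    -- to be `value` gives the partial sums from the same bijection.
    ∑-paths : ∀ {Φ Ψ : List Edge → Carrier} {c} →
              (∀ p → Φ (e ∷ f ∷ p) ≈ c * Ψ (f ∷ p)) →
              ∀ L → ∑ Φ (paths (suc L) e j) ≈ c * ∑ Ψ (paths L f j)
    ∑-paths {Φ} {Ψ} Φ≈cΨ L = trans (∑-paths-suc Φ L e j) (trans
      (reflexive (≡.cong (∑ (Φ ∘ (e ∷_)))
        -- Prepending `e` to `p` gives a path exactly when `p` is a path from `f`, so both filters
        -- keep the same tails in the same order.
        (List.filter-≐ (λ p → isPath? e j (e ∷ p)) (isPath? f j)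
          (to , IsPath-∷⁺ (≡.trans t (≡.sym s))) (edgeSequences L))))
      (∑-paths-* {Φ ∘ (e ∷_)} {Ψ} Φ≈cΨ L j))
      where
      to : ∀ {p} → IsPath e j (e ∷ p) → IsPath f j p
      to r with IsPath-∷⁻ t r
      ... | h , h↤v , r′ with only h↤v
      ...   | ≡.refl = r′

    -- Multiplication by the indeterminate of `e` distinguishes whether its exponent is zero. If it
    -- is, both sides vanish; otherwise the first edge is removed.
    E-relation : E e j ≐ through e f j
    E-relation α = by-exponent (Vec.lookup α e) ≡.refl
      where
      by-exponent : ∀ b → Vec.lookup α e ≡ b → E e j α ≈ through e f j α
      by-exponent zero    αₑ = trans (E-zero {α} j αₑ) (sym (through-zero {α} f j αₑ))
      by-exponent (suc a) αₑ = trans (E-suc {α} j αₑ) (trans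
          (∑-paths {term α} {term (α [ e ]≔ a)} (term-∷ {α} αₑ f) (Vec.sum (α [ e ]≔ a)))
          (through-suc {α} f j αₑ))

    limit-relation : ∀ {x y} → E⟨ e , j ⟩≔ x → E⟨ f , j ⟩≔ y → x ≈ multiplier e f * weight e * y
    limit-relation {x} {y} e⟶x f⟶y = ⟶-unique {partialSum e j ∘ suc} (⟶-suc {partialSum e j} e⟶x)
      (⟶-cong {λ N → c * partialSum f j N} (λ N → sym (recursion N)) refl
              (⟶-* c {partialSum f j} f⟶y))
      where
      c : Carrier
      c = multiplier e f * weight e

      recursion : ∀ N → partialSum e j (suc N) ≈ c * partialSum f j N
      recursion N = trans (partialSum-suc e j N) (trans
        (∑-cong (λ L → ∑ value (paths (suc L) e j)) (λ L → c * ∑ value (paths L f j))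
                (∑-paths {value} {value} (value-∷ e f)) (upTo (suc N)))
        (partialSum-* c f j N))

  -- Recursion at a vertex with two outgoing edges

  module TwoSuccessors {v : Fin m} {e f g : Edge} (f≢g : f ≢ g)
           (t : tgt e ≡ internal v) (s : src f ≡ internal v) (s′ : src g ≡ internal v)
           (only : ∀ {h} → src h ≡ internal v → h ≡ f ⊎ h ≡ g) (j : Fin n) where

    ∑-paths : ∀ {Φ Ψ : List Edge → Carrier} {c d} →
              (∀ p → Φ (e ∷ f ∷ p) ≈ c * Ψ (f ∷ p)) →
              (∀ p → Φ (e ∷ g ∷ p) ≈ d * Ψ (g ∷ p)) →
              ∀ L → ∑ Φ (paths (suc L) e j) ≈
                    c * ∑ Ψ (paths L f j) + d * ∑ Ψ (paths L g j)
    ∑-paths {Φ} {Ψ} Φ≈cΨ Φ≈dΨ L = trans (∑-paths-suc Φ L e j) (trans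
      (∑-filter-⊎ (λ p → isPath? e j (e ∷ p)) (isPath? f j) (isPath? g j) split
        (IsPath-∷⁺ (≡.trans t (≡.sym s))) (IsPath-∷⁺ (≡.trans t (≡.sym s′))) disjoint
        (Φ ∘ (e ∷_)) (edgeSequences L))
      (+-cong (∑-paths-* {Φ ∘ (e ∷_)} {Ψ} Φ≈cΨ L j) (∑-paths-* {Φ ∘ (e ∷_)} {Ψ} Φ≈dΨ L j)))
      where
      split : ∀ {p} → IsPath e j (e ∷ p) → IsPath f j p ⊎ IsPath g j p
      split r with IsPath-∷⁻ t r
      ... | h , h↤v , r′ with only h↤v
      ...   | inj₁ ≡.refl = inj₁ r′
      ...   | inj₂ ≡.refl = inj₂ r′

      -- A list has only one first edge, so `f≢g` prevents a tail from being counted twice.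
      disjoint : ∀ {p} → IsPath f j p → IsPath g j p → ⊥
      disjoint r r′ with IsPath-head r | IsPath-head r′
      ... | _ , ≡.refl | _ , eq = f≢g (List.∷-injectiveˡ eq)

    E-relation : E e j ≐ through e f j ⊞ through e g j
    E-relation α = by-exponent (Vec.lookup α e) ≡.refl
      where
      by-exponent : ∀ b → Vec.lookup α e ≡ b → E e j α ≈ (through e f j ⊞ through e g j) α
      by-exponent zero    αₑ = trans (E-zero {α} j αₑ) (trans (sym (+-identityˡ 0#))
          (sym (+-cong (through-zero {α} f j αₑ) (through-zero {α} g j αₑ))))
      by-exponent (suc a) αₑ = trans (E-suc {α} j αₑ) (trans
          (∑-paths {term α} {term (α [ e ]≔ a)} (term-∷ {α} αₑ f) (term-∷ {α} αₑ g)
            (Vec.sum (α [ e ]≔ a)))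
          (+-cong (through-suc {α} f j αₑ) (through-suc {α} g j αₑ)))

    limit-relation : ∀ {x y z} → E⟨ f , j ⟩≔ x → E⟨ g , j ⟩≔ y → E⟨ e , j ⟩≔ z →
                     z ≈ multiplier e f * weight e * x + multiplier e g * weight e * y
    limit-relation f⟶x g⟶y e⟶z = ⟶-unique {partialSum e j ∘ suc} (⟶-suc {partialSum e j} e⟶z)
      (⟶-cong {λ N → c * partialSum f j N + d * partialSum g j N} (λ N → sym (recursion N)) refl
        (⟶-+ {λ N → c * partialSum f j N} {λ N → d * partialSum g j N}
          (⟶-* c {partialSum f j} f⟶x) (⟶-* d {partialSum g j} g⟶y)))
      where
      c d : Carrier
      c = multiplier e f * weight e
      d = multiplier e g * weight e

      sf sg : ℕ → Carrier
      sf L = c * ∑ value (paths L f j)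
      sg L = d * ∑ value (paths L g j)

      recursion : ∀ N → partialSum e j (suc N) ≈ c * partialSum f j N + d * partialSum g j N
      recursion N = trans (partialSum-suc e j N) (trans
        (∑-cong (λ L → ∑ value (paths (suc L) e j)) (λ L → sf L + sg L)
                (∑-paths {value} {value} (value-∷ e f) (value-∷ e g)) (upTo (suc N))) (trans
        (∑-+ sf sg (upTo (suc N)))
        (+-cong (partialSum-* c f j N) (partialSum-* d g j N))))

  -- Outgoing edges at an internal vertex

  bivalent-outdegree : ∀ v → degree (internal v) ≡ 2 → outdegree (internal v) ≡ 1
  bivalent-outdegree v deg with colour v | perfect v
  ... | black | out = out
  ... | white | in₁ =
    -- Perfectness bounds only the in-degree here; subtracting that one edge from the degree two
    -- leaves one outgoing edge.
    ℕ.suc-injective (≡.trans (≡.cong (ℕ._+ outdegree (internal v)) (≡.sym in₁)) deg)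

  black-outdegree : ∀ v → colour v ≡ black → outdegree (internal v) ≡ 1
  black-outdegree v c with colour v | perfect v
  black-outdegree v ≡.refl | black | out = out

  white-outdegree : ∀ v → degree (internal v) ≡ 3 → colour v ≡ white → outdegree (internal v) ≡ 2
  white-outdegree v deg c with colour v | perfect v
  white-outdegree v deg ≡.refl | white | in₁ =
    ℕ.suc-injective (≡.trans (≡.cong (ℕ._+ outdegree (internal v)) (≡.sym in₁)) deg)

  outgoing : ∀ {u e} → src e ≡ u → e ∈ filter (λ f → src f ≟ᵥ u) (allFin k)
  outgoing {u} {e} s = ∈-filter⁺ (λ f → src f ≟ᵥ u) (∈-allFin e) s

  unique-successor : ∀ {u f} → outdegree u ≡ 1 → src f ≡ u → ∀ {h} → src h ≡ u → h ≡ f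
  unique-successor out s s′ = length≡1⇒≡ out (outgoing s) (outgoing s′)

  two-successors : ∀ {u f g} → outdegree u ≡ 2 → f ≢ g → src f ≡ u → src g ≡ u →
                   ∀ {h} → src h ≡ u → h ≡ f ⊎ h ≡ g
  two-successors out f≢g s s′ s″ =
    length≡2⇒≡⊎≡ out (outgoing s) (outgoing s′) f≢g (outgoing s″)

lemma3p10 :
  (ℝ : Reals) {n m k : ℕ} (𝒩 : PlabicNetwork ℝ n m k) (𝔩 : GaugeRayDirection 𝒩) →
  let open Reals ℝ
      open PlabicNetwork 𝒩
      open EdgeVectors 𝒩 𝔩
  in
  -- (1) bivalent vertices
  ((v : Fin m) (e f : Edge) →
     degree (internal v) ≡ 2 → tgt e ≡ internal v → src f ≡ internal v →
     (j : Fin n) →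
       (E e j ≐ (-1^ (+ int e +ℤ wind e f)) ⊙ 𝓌 e ⊛ E f j)
     × (∀ {x y} → E⟨ e , j ⟩≔ x → E⟨ f , j ⟩≔ y →
          x ≈ (-1^ (+ int e +ℤ wind e f)) * weight e * y))
  ×
  -- (2) trivalent black vertices
  ((v : Fin m) (e₁ e₂ e₃ : Edge) →
     degree (internal v) ≡ 3 → colour v ≡ black → e₂ ≢ e₃ →
     tgt e₂ ≡ internal v → tgt e₃ ≡ internal v → src e₁ ≡ internal v →
     (j : Fin n) →
       (E e₂ j ≐ (-1^ (+ int e₂ +ℤ wind e₂ e₁)) ⊙ 𝓌 e₂ ⊛ E e₁ j)
     × (E e₃ j ≐ (-1^ (+ int e₃ +ℤ wind e₃ e₁)) ⊙ 𝓌 e₃ ⊛ E e₁ j)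
     × (∀ {x₁ x₂} → E⟨ e₁ , j ⟩≔ x₁ → E⟨ e₂ , j ⟩≔ x₂ →
          x₂ ≈ (-1^ (+ int e₂ +ℤ wind e₂ e₁)) * weight e₂ * x₁)
     × (∀ {x₁ x₃} → E⟨ e₁ , j ⟩≔ x₁ → E⟨ e₃ , j ⟩≔ x₃ →
          x₃ ≈ (-1^ (+ int e₃ +ℤ wind e₃ e₁)) * weight e₃ * x₁))
  ×
  -- (3) trivalent white vertices
  ((v : Fin m) (e₁ e₂ e₃ : Edge) →
     degree (internal v) ≡ 3 → colour v ≡ white → e₁ ≢ e₂ →
     tgt e₃ ≡ internal v → src e₁ ≡ internal v → src e₂ ≡ internal v →
     (j : Fin n) →
       (E e₃ j ≐ (-1^ (+ int e₃ +ℤ wind e₃ e₁)) ⊙ 𝓌 e₃ ⊛ E e₁ j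
               ⊞ (-1^ (+ int e₃ +ℤ wind e₃ e₂)) ⊙ 𝓌 e₃ ⊛ E e₂ j)
     × (∀ {x₁ x₂ x₃} → E⟨ e₁ , j ⟩≔ x₁ → E⟨ e₂ , j ⟩≔ x₂ → E⟨ e₃ , j ⟩≔ x₃ →
          x₃ ≈ (-1^ (+ int e₃ +ℤ wind e₃ e₁)) * weight e₃ * x₁
             + (-1^ (+ int e₃ +ℤ wind e₃ e₂)) * weight e₃ * x₂))
lemma3p10 ℝ 𝒩 𝔩 =
    (λ v e f deg t s j →
      let open UniqueSuccessor t s (unique-successor (bivalent-outdegree v deg) s) j in
      E-relation , λ {x} {y} → limit-relation {x} {y})
  , (λ v e₁ e₂ e₃ deg c e₂≢e₃ t₂ t₃ s j →
      -- Both incoming edges have the same sole successor, so the recursion applies to each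
      -- separately.
      let only : ∀ {h} → src h ≡ internal v → h ≡ e₁
          only = unique-successor (black-outdegree v c) s
          module U₂ = UniqueSuccessor t₂ s only j
          module U₃ = UniqueSuccessor t₃ s only j
      in
      U₂.E-relation , U₃.E-relation ,
      (λ {x₁} {x₂} y x → U₂.limit-relation {x₂} {x₁} x y) ,
      (λ {x₁} {x₃} y x → U₃.limit-relation {x₃} {x₁} x y))
  , (λ v e₁ e₂ e₃ deg c e₁≢e₂ t s₁ s₂ j →
      let open TwoSuccessors e₁≢e₂ t s₁ s₂
                 (two-successors (white-outdegree v deg c) e₁≢e₂ s₁ s₂) j
      in E-relation , λ {x} {y} {z} → limit-relation {x} {y} {z})
  where
  open PlabicNetwork 𝒩
  open PathRecursion 𝒩 𝔩
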